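{- Let $C_n(t)$ denote the Narayana polynomials and $F_n(x,s)$ the Fibonacci polynomials. Then for all integers $n\ge 0$, as polynomials in $t$, $$\det\bigl(C_{i+j+1}(t)+C_{i+j+2}(t)\bigr)_{i,j=0}^{n-1}=(-1)^n\,t^{\binom n2}\,F_{n+1}(-t-2,-t).$$
   Context: The Narayana polynomials are $C_0(t)=1$ and $C_n(t)=\sum_{k=0}^{n}\binom nk\binom{n-1}{k}\frac{1}{k+1}t^k$ for $n>0$ (so $C_1=1$, $C_2=1+t$, $C_3=1+3t+t^2$). The Fibonacci polynomials are defined by $F_0(x,s)=0$, $F_1(x,s)=1$, $F_n(x,s)=xF_{n-1}(x,s)+sF_{n-2}(x,s)$ for $n\ge 2$. The determinant of the empty ($0\times 0$) matrix is $1$. -}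

module Defs where

open import Algebra.Bundles.Raw using (RawRing)
import Algebra.Definitions.RawSemiring as RawSemiringDefs
open import Data.Fin.Base using (Fin; zero; suc; toℕ)
open import Data.Integer.Base using (+_)
open import Data.List.Base using (List; []; _∷_; map)
open import Data.Nat.Base as ℕ using (ℕ; zero; suc)
open import Data.Nat.Combinatorics using (_C_)
open import Data.Rational.Base as ℚ using (ℚ; 0ℚ; 1ℚ)
open import Data.Vec.Functional using (Vector; removeAt)
open import Level using (0ℓ)
open import Relation.Binary.PropositionalEquality using (_≡_)

module _ {c ℓ} (R : RawRing c ℓ) where
  open RawRing R
  open RawSemiringDefs rawSemiring using (sum; _^_)

  -- Laplace expansion along row 0.
  det : ∀ {n} → (Fin n → Fin n → Carrier) → Carrier
  det {zero}  M = 1#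
  det {suc n} M = sum λ j →
    (- 1#) ^ toℕ j * M zero j * det (λ i → removeAt (M (suc i)) j)

  fib : ℕ → Carrier → Carrier → Carrier
  fib zero          x s = 0#
  fib (suc zero)    x s = 1#
  fib (suc (suc n)) x s = x * fib (suc n) x s + s * fib n x s

-- ℚ[t].  A list a₀ ∷ a₁ ∷ … stands for a₀ + a₁ t + ⋯ .  Trailing zeros are
-- allowed, so the equality of polynomials is _≈_, not _≡_.

Poly : Set
Poly = List ℚ

coeff : Poly → ℕ → ℚ
coeff []      k       = 0ℚ
coeff (a ∷ p) zero    = a
coeff (a ∷ p) (suc k) = coeff p k

infix  4 _≈_
infixl 6 _+_ _-_
infixl 7 _*_
infix  8 -_

-- A record, so that p and q can be inferred from a proof of p ≈ q.
record _≈_ (p q : Poly) : Set where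
  constructor mk≈
  field
    coeff-≡ : ∀ k → coeff p k ≡ coeff q k

_+_ : Poly → Poly → Poly
[]      + q       = q
(a ∷ p) + []      = a ∷ p
(a ∷ p) + (b ∷ q) = (a ℚ.+ b) ∷ (p + q)

-_ : Poly → Poly
- p = map ℚ.-_ p

_-_ : Poly → Poly → Poly
p - q = p + (- q)

-- (a + t p) q = a q + t (p q)
_*_ : Poly → Poly → Poly
[]      * q = []
(a ∷ p) * q = map (a ℚ.*_) q + (0ℚ ∷ p * q)

const : ℚ → Poly
const a = a ∷ []

t : Poly
t = 0ℚ ∷ 1ℚ ∷ []

polyRawRing : RawRing 0ℓ 0ℓ
polyRawRing = record
  { Carrier = Poly
  ; _≈_     = _≈_
  ; _+_     = _+_
  ; _*_     = _*_
  ; -_      = -_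
  ; 0#      = []
  ; 1#      = const 1ℚ
  }

open RawSemiringDefs (RawRing.rawSemiring polyRawRing) public using (sum; _^_)

-- In the second clause n = suc m, so that n - 1 is m.
narayana : ℕ → Poly
narayana zero    = const 1ℚ
narayana (suc m) = sum {suc (suc m)} λ i → let k = toℕ i in
  const ((+ ((suc m C k) ℕ.* (m C k))) ℚ./ suc k) * t ^ k

{-# OPTIONS --safe #-}

-- The shifted Narayana polynomials C_(m+1)(t) are the moments m ↦ A_(m,0) of
-- weighted Motzkin paths: A_(m,k) sums the paths of length m from height 0 to
-- height k, with weight 1 + t on level steps and t on down steps.  Since
-- C_(i+j+1) = Σ_k A_(i,k) t^k A_(j,k), the matrix of the theorem factors as
-- (A D) K Aᵀ, where A is lower unitriangular, D = diag(t^k), and K is tridiagonal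
-- with diagonal 2 + t, superdiagonal t and subdiagonal 1.  Its determinant is
-- t^(n C 2) det K, and expanding det K gives the Fibonacci recurrence.
-- That C_(m+1) = A_(m,0) follows from the coefficients of A_(m,k), which are
-- 2 × 2 minors of Pascal's triangle.
module Submission where

open import Algebra.Bundles using (AbelianGroup; CommutativeRing)
open import Algebra.Bundles.Raw using (RawRing)
open import Algebra.Structures using (IsAbelianGroup)
open import Data.Fin.Base using (Fin; zero; suc; toℕ; punchIn)
open import Data.Fin.Properties using (toℕ<n)
open import Data.Integer.Base as ℤ using (ℤ; +_)
import Data.Integer.Properties as ℤ
open import Data.Integer.Tactic.RingSolver using (solve-∀)
open import Data.Nat.Base as ℕ using (ℕ; zero; suc; z≤n; s≤s)
open import Data.Nat.Combinatorics
  using (_C_; nC1≡n; nCn≡1; nCk≡nC[n∸k]; k>n⇒nCk≡0; nCk+nC[k+1]≡[n+1]C[k+1])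
import Data.Nat.Properties as ℕ
open import Data.Product.Base using (_,_)
open import Data.Rational.Base as ℚ using (ℚ; 0ℚ; 1ℚ)
import Data.Rational.Properties as ℚ
open import Data.Rational.Unnormalised.Base as ℚᵘ using (mkℚᵘ; *≡*)
import Data.Rational.Unnormalised.Properties as ℚᵘ
open import Data.Vec.Functional using (Vector; removeAt; tail)
open import Function.Base using (_∘_)
open import Level using (0ℓ)
open import Relation.Binary.PropositionalEquality as ≡ using (_≡_)
import Relation.Binary.Reasoning.Setoid as SetoidReasoning
open import Defs using (det; fib)

-- Let L be the functional with L(x^m) = C_(m+1)(t). The entries are L(x^i (1 + x) x^j), so the
-- factor 1 + x raises the diagonal weight 1 + t of the Motzkin paths to 2 + t. Row i of A holds the
-- coordinates of x^i in the basis p_k, and t^k is the norm L(p_k p_k). Cutting the factorization at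
-- size n needs care: x^(j+1) also occurs and may reach height n. The sum over heights is still
-- exact, because x^i with i < n stays below n. The determinant facts hold over any commutative
-- ring, so no step divides by 2 or by t; in particular D is never inverted or split between the two
-- factors. The denominators k + 1 of the Narayana coefficients are avoided in the same spirit: the
-- minors of Pascal's triangle are integers that obey the Motzkin recurrence by Pascal's rule alone,
-- and they meet the Narayana coefficients only after multiplication by k + 1.

module _ {c ℓ} (R : CommutativeRing c ℓ) where
  open CommutativeRing R hiding (zero)
  open Data.Vec.Functional using (_∷_)
  open import Algebra.Definitions.RawSemiring (RawRing.rawSemiring rawRing) using (_^_; product)
  open import Algebra.Properties.Ring ring using (-1*x≈-x; -‿involutive)
  open import Algebra.Properties.Semiring.Sum semiring
    using (sum; sum-syntax; sum-cong-≋; ∑-comm; ∑-distrib-+; *-distribˡ-sum; sum-replicate-zero)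
  open import Algebra.Solver.Ring.NaturalCoefficients.Default commutativeSemiring
    using (solve; _:=_; _:+_; _:*_; con)
  open SetoidReasoning setoid

  Matrix : ℕ → Set c
  Matrix n = Fin n → Fin n → Carrier

  ∣_∣ : ∀ {n} → Matrix n → Carrier
  ∣ M ∣ = det rawRing M

  sign : ∀ {n} → Fin n → Carrier
  sign i = (- 1#) ^ toℕ i

  -1*-1≈1 : - 1# * - 1# ≈ 1#
  -1*-1≈1 = trans (-1*x≈-x (- 1#)) (-‿involutive 1#)

  sum-cong : ∀ {n} {f g : Vector Carrier n} → (∀ i → f i ≈ g i) → sum f ≈ sum g
  sum-cong = sum-cong-≋

  sum-zero : ∀ {n} {f : Vector Carrier n} → (∀ i → f i ≈ 0#) → sum f ≈ 0#
  sum-zero {n} f≈0 = trans (sum-cong f≈0) (sum-replicate-zero n)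

  -- Determinants

  det-cong : ∀ {n} (M N : Matrix n) → (∀ i j → M i j ≈ N i j) → ∣ M ∣ ≈ ∣ N ∣
  det-cong {zero}  M N M≈N = refl
  det-cong {suc n} M N M≈N = sum-cong λ j →
    *-cong (*-congˡ {x = sign j} (M≈N zero j))
      (det-cong (λ r → removeAt (M (suc r)) j) (λ r → removeAt (N (suc r)) j) λ r k → M≈N (suc r) (punchIn j k))

  columnMinor : ∀ {n} → Matrix (suc n) → Fin (suc n) → Matrix n
  columnMinor M i r k = M (punchIn i r) (suc k)

  -- After the common (0,0) term, expanding the minors once more gives on both
  -- sides the same double sum over the remaining entries of row 0 and column 0.
  det-expand-column : ∀ {n} (M : Matrix (suc n)) →
    ∣ M ∣ ≈ ∑[ i < suc n ] (sign i * M i zero * ∣ columnMinor M i ∣)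
  det-expand-column {zero}  M = refl
  det-expand-column {suc n} M = +-congˡ (begin
    ∑[ j < suc n ] (sign (suc j) * M zero (suc j) * ∣ (λ r → removeAt (M (suc r)) (suc j)) ∣)
      ≈⟨ sum-cong (λ j → trans (*-congˡ (det-expand-column (λ r → removeAt (M (suc r)) (suc j))))
           (*-distribˡ-sum (sign (suc j) * M zero (suc j))
             (λ i → sign i * M (suc i) zero * D i j))) ⟩
    ∑[ j < suc n ] ∑[ i < suc n ] (sign (suc j) * M zero (suc j) * (sign i * M (suc i) zero * D i j))
      ≈⟨ ∑-comm (λ j i → sign (suc j) * M zero (suc j) * (sign i * M (suc i) zero * D i j)) ⟩
    ∑[ i < suc n ] ∑[ j < suc n ] (sign (suc j) * M zero (suc j) * (sign i * M (suc i) zero * D i j))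
      ≈⟨ sum-cong (λ i → sum-cong λ j →
           solve 6 (λ u s s′ a b d → u :* s :* a :* (s′ :* b :* d) := u :* s′ :* b :* (s :* a :* d))
             refl (- 1#) (sign j) (sign i) (M zero (suc j)) (M (suc i) zero) (D i j)) ⟩
    ∑[ i < suc n ] ∑[ j < suc n ] (sign (suc i) * M (suc i) zero * (sign j * M zero (suc j) * D i j))
      ≈⟨ sum-cong (λ i → *-distribˡ-sum (sign (suc i) * M (suc i) zero)
           (λ j → sign j * M zero (suc j) * D i j)) ⟨
    ∑[ i < suc n ] (sign (suc i) * M (suc i) zero * ∣ columnMinor M (suc i) ∣) ∎)
    where
    D : Fin (suc n) → Fin (suc n) → Carrier
    D i j = ∣ (λ r k → M (suc (punchIn i r)) (suc (punchIn j k))) ∣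

  -- Row expansion of the transpose is column expansion of `M` with transposed minors, and the
  -- induction applies to those.
  det-transpose : ∀ {n} (M : Matrix n) → ∣ (λ i j → M j i) ∣ ≈ ∣ M ∣
  det-transpose {zero}  M = refl
  det-transpose {suc n} M = begin
    ∑[ j < suc n ] (sign j * M j zero * ∣ (λ r k → columnMinor M j k r) ∣)
      ≈⟨ sum-cong (λ j → *-congˡ {x = sign j * M j zero} (det-transpose (columnMinor M j))) ⟩
    ∑[ j < suc n ] (sign j * M j zero * ∣ columnMinor M j ∣)
      ≈⟨ det-expand-column M ⟨
    ∣ M ∣ ∎


  -- A vector built with `_∷_` reduces only at a known index, so a minor of `v ∷ w ∷ N` takes the
  -- same form again only after a case split on the row.
  columnMinor₀ : ∀ {n} (v w : Vector Carrier (suc (suc n))) (N : Fin n → Vector Carrier (suc (suc n))) →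
    ∣ columnMinor (v ∷ w ∷ N) zero ∣ ≈ ∣ tail w ∷ (tail ∘ N) ∣
  columnMinor₀ v w N = det-cong (columnMinor (v ∷ w ∷ N) zero) (tail w ∷ (tail ∘ N))
    λ { zero k → refl ; (suc r) k → refl }

  columnMinor₁ : ∀ {n} (v w : Vector Carrier (suc (suc n))) (N : Fin n → Vector Carrier (suc (suc n))) →
    ∣ columnMinor (v ∷ w ∷ N) (suc zero) ∣ ≈ ∣ tail v ∷ (tail ∘ N) ∣
  columnMinor₁ v w N = det-cong (columnMinor (v ∷ w ∷ N) (suc zero)) (tail v ∷ (tail ∘ N))
    λ { zero k → refl ; (suc r) k → refl }

  columnMinor₂ : ∀ {n} (v w : Vector Carrier (suc (suc (suc n))))
    (N : Fin (suc n) → Vector Carrier (suc (suc (suc n)))) i →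
    ∣ columnMinor (v ∷ w ∷ N) (suc (suc i)) ∣ ≈ ∣ tail v ∷ tail w ∷ (tail ∘ removeAt N i) ∣
  columnMinor₂ v w N i = det-cong (columnMinor (v ∷ w ∷ N) (suc (suc i))) (tail v ∷ tail w ∷ (tail ∘ removeAt N i))
    λ { zero k → refl ; (suc zero) k → refl ; (suc (suc r)) k → refl }

  -- In the expansion along column 0 the two leading terms trade places with opposite signs. Every
  -- other minor still has both rows on top, so the induction applies.
  det-swap : ∀ {n} (v w : Vector Carrier (suc (suc n))) (N : Fin n → Vector Carrier (suc (suc n))) →
    ∣ v ∷ w ∷ N ∣ ≈ - 1# * ∣ w ∷ v ∷ N ∣
  det-swap {n} v w N = begin
    ∣ v ∷ w ∷ N ∣
      ≈⟨ det-expand-column (v ∷ w ∷ N) ⟩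
    1# * v₀ * ∣ columnMinor (v ∷ w ∷ N) zero ∣ +
      (- 1# * 1# * w₀ * ∣ columnMinor (v ∷ w ∷ N) (suc zero) ∣ + rest v w)
      ≈⟨ +-cong (*-congˡ (columnMinor₀ v w N)) (+-cong (*-congˡ (columnMinor₁ v w N)) (rest-swap N)) ⟩
    1# * v₀ * W + (- 1# * 1# * w₀ * V + - 1# * rest w v)
      -- The solver is one for semirings and sees `- 1#` as a variable `u`, so the factor `u * u`
      -- has to be inserted by hand.
      ≈⟨ +-congʳ (*-congʳ (*-congʳ -1*-1≈1)) ⟨
    - 1# * - 1# * v₀ * W + (- 1# * 1# * w₀ * V + - 1# * rest w v)
      ≈⟨ solve 6 (λ u a b A B r → u :* u :* a :* A :+ (u :* con 1 :* b :* B :+ u :* r)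
           := u :* (con 1 :* b :* B :+ (u :* con 1 :* a :* A :+ r))) refl (- 1#) v₀ w₀ W V (rest w v) ⟩
    - 1# * (1# * w₀ * V + (- 1# * 1# * v₀ * W + rest w v))
      ≈⟨ *-congˡ (+-cong (*-congˡ (columnMinor₀ w v N)) (+-congʳ (*-congˡ (columnMinor₁ w v N)))) ⟨
    - 1# * (1# * w₀ * ∣ columnMinor (w ∷ v ∷ N) zero ∣ +
      (- 1# * 1# * v₀ * ∣ columnMinor (w ∷ v ∷ N) (suc zero) ∣ + rest w v))
      ≈⟨ *-congˡ (det-expand-column (w ∷ v ∷ N)) ⟨
    - 1# * ∣ w ∷ v ∷ N ∣ ∎
    where
    v₀ = v zero
    w₀ = w zero
    V = ∣ tail v ∷ (tail ∘ N) ∣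
    W = ∣ tail w ∷ (tail ∘ N) ∣
    summand : ∀ {n} (N : Fin n → Vector Carrier (suc (suc n))) (v w : Vector Carrier (suc (suc n))) → Vector Carrier n
    summand N v w i = sign (suc (suc i)) * N i zero * ∣ columnMinor (v ∷ w ∷ N) (suc (suc i)) ∣
    rest : (v w : Vector Carrier (suc (suc n))) → Carrier
    rest v w = sum (summand N v w)
    rest-swap : ∀ {n} {v w : Vector Carrier (suc (suc n))} (N : Fin n → Vector Carrier (suc (suc n))) →
      sum (summand N v w) ≈ - 1# * sum (summand N w v)
    rest-swap {zero} N = sym (zeroʳ (- 1#))
    rest-swap {suc n} {v} {w} N = begin
      sum (summand N v w)
        ≈⟨ sum-cong (λ i → begin
             summand N v w i
               ≈⟨ *-congˡ (columnMinor₂ v w N i) ⟩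
             x i * ∣ tail v ∷ tail w ∷ (tail ∘ removeAt N i) ∣
               ≈⟨ *-congˡ (det-swap (tail v) (tail w) (tail ∘ removeAt N i)) ⟩
             x i * (- 1# * ∣ tail w ∷ tail v ∷ (tail ∘ removeAt N i) ∣)
               ≈⟨ solve 3 (λ a u d → a :* (u :* d) := u :* (a :* d)) refl (x i) (- 1#) _ ⟩
             - 1# * (x i * ∣ tail w ∷ tail v ∷ (tail ∘ removeAt N i) ∣)
               ≈⟨ *-congˡ (*-congˡ (columnMinor₂ w v N i)) ⟨
             - 1# * summand N w v i ∎) ⟩
      ∑[ i < suc n ] (- 1# * summand N w v i)
        ≈⟨ *-distribˡ-sum (- 1#) (summand N w v) ⟨
      - 1# * sum (summand N w v) ∎
      where
      x : Fin (suc n) → Carrier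
      x i = sign (suc (suc i)) * N i zero

  -- `det-swap` alone would give only that twice the determinant vanishes. Instead the two leading
  -- terms of the column expansion cancel, and the other minors again have equal top rows.
  det-equal-rows : ∀ {n} (v : Vector Carrier (suc (suc n))) (N : Fin n → Vector Carrier (suc (suc n))) →
    ∣ v ∷ v ∷ N ∣ ≈ 0#
  det-equal-rows {n} v N = begin
    ∣ v ∷ v ∷ N ∣
      ≈⟨ det-expand-column (v ∷ v ∷ N) ⟩
    1# * v zero * ∣ columnMinor (v ∷ v ∷ N) zero ∣ +
      (- 1# * 1# * v zero * ∣ columnMinor (v ∷ v ∷ N) (suc zero) ∣ + sum (summand N v))
      ≈⟨ +-cong (*-congˡ (columnMinor₀ v v N)) (+-cong (*-congˡ (columnMinor₁ v v N)) (sum-zero (summand≈0 N v))) ⟩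
    1# * v zero * V + (- 1# * 1# * v zero * V + 0#)
      ≈⟨ solve 3 (λ u a A → con 1 :* a :* A :+ (u :* con 1 :* a :* A :+ con 0) := (con 1 :+ u) :* (a :* A))
           refl (- 1#) (v zero) V ⟩
    (1# + - 1#) * (v zero * V)
      ≈⟨ *-congʳ (-‿inverseʳ 1#) ⟩
    0# * (v zero * V)
      ≈⟨ zeroˡ _ ⟩
    0# ∎
    where
    V = ∣ tail v ∷ (tail ∘ N) ∣
    summand : ∀ {n} (N : Fin n → Vector Carrier (suc (suc n))) (v : Vector Carrier (suc (suc n))) → Vector Carrier n
    summand N v i = sign (suc (suc i)) * N i zero * ∣ columnMinor (v ∷ v ∷ N) (suc (suc i)) ∣
    summand≈0 : ∀ {n} (N : Fin n → Vector Carrier (suc (suc n))) (v : Vector Carrier (suc (suc n))) i →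
      summand N v i ≈ 0#
    summand≈0 {suc n} N v i = trans
      (*-congˡ {x = sign (suc (suc i)) * N i zero}
        (trans (columnMinor₂ v v N i) (det-equal-rows (tail v) (tail ∘ removeAt N i))))
      (zeroʳ _)

  det-linear-row₀ : ∀ {n} a b (v w : Vector Carrier (suc n)) (N : Fin n → Vector Carrier (suc n)) →
    ∣ (λ j → a * v j + b * w j) ∷ N ∣ ≈ a * ∣ v ∷ N ∣ + b * ∣ w ∷ N ∣
  det-linear-row₀ {n} a b v w N = begin
    ∑[ j < suc n ] (sign j * (a * v j + b * w j) * d j)
      ≈⟨ sum-cong (λ j → solve 6 (λ s a b x y d →
           s :* (a :* x :+ b :* y) :* d := a :* (s :* x :* d) :+ b :* (s :* y :* d))
             refl (sign j) a b (v j) (w j) (d j)) ⟩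
    ∑[ j < suc n ] (a * (sign j * v j * d j) + b * (sign j * w j * d j))
      ≈⟨ ∑-distrib-+ (λ j → a * (sign j * v j * d j)) (λ j → b * (sign j * w j * d j)) ⟩
    ∑[ j < suc n ] (a * (sign j * v j * d j)) + ∑[ j < suc n ] (b * (sign j * w j * d j))
      ≈⟨ +-cong (*-distribˡ-sum a (λ j → sign j * v j * d j)) (*-distribˡ-sum b (λ j → sign j * w j * d j)) ⟨
    a * ∣ v ∷ N ∣ + b * ∣ w ∷ N ∣ ∎
    where
    d : Fin (suc n) → Carrier
    d j = ∣ (λ i → removeAt (N i) j) ∣

  det-cong-minors₀ : ∀ {n} (v : Vector Carrier (suc n)) (M N : Fin n → Vector Carrier (suc n)) →
    (∀ j → ∣ (λ i → removeAt (M i) j) ∣ ≈ ∣ (λ i → removeAt (N i) j) ∣) → ∣ v ∷ M ∣ ≈ ∣ v ∷ N ∣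
  det-cong-minors₀ v M N M≈N = sum-cong λ j → *-congˡ {x = sign j * v j} (M≈N j)

  -- Swapping the first two rows makes row 1 the leading row, in which the
  -- determinant is linear; the other rows are then handled in its minors.
  det-add-row₀ : ∀ {n} (v : Vector Carrier (suc n)) (N : Fin n → Vector Carrier (suc n)) (a : Vector Carrier n) →
    ∣ v ∷ (λ i j → a i * v j + N i j) ∣ ≈ ∣ v ∷ N ∣
  det-add-row₀ {zero}  v N a = refl
  det-add-row₀ {suc n} v N a = begin
    ∣ v ∷ N′ ∣
      ≈⟨ det-cong (v ∷ N′) (v ∷ N′ zero ∷ tail N′) (λ { zero j → refl ; (suc zero) j → refl ; (suc (suc i)) j → refl }) ⟩
    ∣ v ∷ N′ zero ∷ tail N′ ∣
      ≈⟨ det-swap v (N′ zero) (tail N′) ⟩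
    - 1# * ∣ N′ zero ∷ v ∷ tail N′ ∣
      ≈⟨ *-congˡ (begin
           ∣ N′ zero ∷ v ∷ tail N′ ∣
             ≈⟨ det-cong (N′ zero ∷ v ∷ tail N′) ((λ j → a zero * v j + 1# * N zero j) ∷ v ∷ tail N′)
                  (λ { zero j → +-congˡ (sym (*-identityˡ _)) ; (suc i) j → refl }) ⟩
           ∣ (λ j → a zero * v j + 1# * N zero j) ∷ v ∷ tail N′ ∣
             ≈⟨ det-linear-row₀ (a zero) 1# v (N zero) (v ∷ tail N′) ⟩
           a zero * ∣ v ∷ v ∷ tail N′ ∣ + 1# * ∣ N zero ∷ v ∷ tail N′ ∣
             ≈⟨ +-cong (trans (*-congˡ (det-equal-rows v (tail N′))) (zeroʳ (a zero))) (*-identityˡ _) ⟩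
           0# + ∣ N zero ∷ v ∷ tail N′ ∣
             ≈⟨ +-identityˡ _ ⟩
           ∣ N zero ∷ v ∷ tail N′ ∣
             ≈⟨ det-cong-minors₀ (N zero) (v ∷ tail N′) (v ∷ tail N) minor ⟩
           ∣ N zero ∷ v ∷ tail N ∣ ∎) ⟩
    - 1# * ∣ N zero ∷ v ∷ tail N ∣
      ≈⟨ det-swap v (N zero) (tail N) ⟨
    ∣ v ∷ N zero ∷ tail N ∣
      ≈⟨ det-cong (v ∷ N) (v ∷ N zero ∷ tail N) (λ { zero j → refl ; (suc zero) j → refl ; (suc (suc i)) j → refl }) ⟨
    ∣ v ∷ N ∣ ∎
    where
    N′ : Fin (suc n) → Vector Carrier (suc (suc n))
    N′ i j = a i * v j + N i j
    minor : ∀ j → ∣ (λ i → removeAt ((v ∷ tail N′) i) j) ∣ ≈ ∣ (λ i → removeAt ((v ∷ tail N) i) j) ∣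
    minor j = begin
      ∣ (λ i → removeAt ((v ∷ tail N′) i) j) ∣
        ≈⟨ det-cong (λ i → removeAt ((v ∷ tail N′) i) j) (removeAt v j ∷ (λ i → removeAt (tail N′ i) j))
             (λ { zero k → refl ; (suc i) k → refl }) ⟩
      ∣ removeAt v j ∷ (λ i k → a (suc i) * removeAt v j k + removeAt (tail N i) j k) ∣
        ≈⟨ det-add-row₀ (removeAt v j) (λ i → removeAt (tail N i) j) (a ∘ suc) ⟩
      ∣ removeAt v j ∷ (λ i → removeAt (tail N i) j) ∣
        ≈⟨ det-cong (λ i → removeAt ((v ∷ tail N) i) j) (removeAt v j ∷ (λ i → removeAt (tail N i) j))
             (λ { zero k → refl ; (suc i) k → refl }) ⟨
      ∣ (λ i → removeAt ((v ∷ tail N) i) j) ∣ ∎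

  -- Row 0 of the product is a multiple of row 0 of `X`. `det-add-row₀` clears that row from the
  -- rows below, and the minors left over are again products of this shape, with row 0 and column 0
  -- of `L` dropped.
  det-lower-triangular-* : ∀ {n} (L X : Matrix n) → (∀ i k → toℕ i ℕ.< toℕ k → L i k ≈ 0#) →
    ∣ (λ i j → ∑[ k < n ] (L i k * X k j)) ∣ ≈ product (λ i → L i i) * ∣ X ∣
  det-lower-triangular-* {zero}  L X L≈0 = sym (*-identityˡ 1#)
  det-lower-triangular-* {suc n} L X L≈0 = begin
    ∣ (λ i j → ∑[ k < suc n ] (L i k * X k j)) ∣
      -- The summand `0# * x j` is padding: it lets linearity in row 0 serve as scaling.
      ≈⟨ det-cong (λ i j → ∑[ k < suc n ] (L i k * X k j)) ((λ j → L zero zero * x j + 0# * x j) ∷ N′)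
           (λ { zero j → +-congˡ (trans (sum-zero (λ k → trans (*-congʳ (L≈0 zero (suc k) (s≤s z≤n))) (zeroˡ _)))
                                        (sym (zeroˡ (x j))))
              ; (suc i) j → refl }) ⟩
    ∣ (λ j → L zero zero * x j + 0# * x j) ∷ N′ ∣
      ≈⟨ det-linear-row₀ (L zero zero) 0# x x N′ ⟩
    L zero zero * ∣ x ∷ N′ ∣ + 0# * ∣ x ∷ N′ ∣
      ≈⟨ trans (+-congˡ (zeroˡ _)) (+-identityʳ _) ⟩
    L zero zero * ∣ x ∷ N′ ∣
      ≈⟨ *-congˡ (det-add-row₀ x N (λ i → L (suc i) zero)) ⟩
    L zero zero * ∣ x ∷ N ∣
      ≈⟨ *-congˡ (sum-cong λ j → *-congˡ {x = sign j * x j}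
           (det-lower-triangular-* (λ i k → L (suc i) (suc k)) (λ k → removeAt (X (suc k)) j)
             (λ i k i<k → L≈0 (suc i) (suc k) (s≤s i<k)))) ⟩
    L zero zero * ∑[ j < suc n ] (sign j * x j * (p * d j))
      ≈⟨ *-congˡ (trans
           (sum-cong (λ j → solve 4 (λ s x p d → s :* x :* (p :* d) := p :* (s :* x :* d)) refl (sign j) (x j) p (d j)))
           (sym (*-distribˡ-sum p (λ j → sign j * x j * d j)))) ⟩
    L zero zero * (p * ∣ X ∣)
      ≈⟨ *-assoc _ _ _ ⟨
    L zero zero * p * ∣ X ∣ ∎
    where
    x : Vector Carrier (suc n)
    x = X zero
    N N′ : Fin n → Vector Carrier (suc n)
    N i j = ∑[ k < n ] (L (suc i) (suc k) * X (suc k) j)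
    N′ i j = L (suc i) zero * x j + N i j
    p : Carrier
    p = product (λ i → L (suc i) (suc i))
    d : Fin (suc n) → Carrier
    d j = ∣ (λ i → removeAt (X (suc i)) j) ∣

  -- Finite sums and products

  ∑-shift : ∀ N (f : ℕ → Carrier) →
    f 0 + ∑[ k < N ] f (suc (toℕ k)) ≈ ∑[ k < N ] f (toℕ k) + f N
  ∑-shift zero    f = +-comm (f 0) 0#
  ∑-shift (suc N) f = begin
    f 0 + (f 1 + ∑[ k < N ] f (suc (suc (toℕ k))))
      ≈⟨ +-congˡ (∑-shift N (f ∘ suc)) ⟩
    f 0 + (∑[ k < N ] f (suc (toℕ k)) + f (suc N))
      ≈⟨ +-assoc _ _ _ ⟨
    f 0 + ∑[ k < N ] f (suc (toℕ k)) + f (suc N) ∎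

  ∑-truncate : ∀ n m (f : ℕ → Carrier) → (∀ k → n ℕ.≤ k → f k ≈ 0#) →
    ∑[ k < n ℕ.+ m ] f (toℕ k) ≈ ∑[ k < n ] f (toℕ k)
  ∑-truncate zero    m f f≈0 = sum-zero {m} (λ k → f≈0 (toℕ k) z≤n)
  ∑-truncate (suc n) m f f≈0 = +-congˡ (∑-truncate n m (f ∘ suc) (λ k n≤k → f≈0 (suc k) (s≤s n≤k)))

  product-one : ∀ {n} {f : Vector Carrier n} → (∀ i → f i ≈ 1#) → product f ≈ 1#
  product-one {zero}  f≈1 = refl
  product-one {suc n} f≈1 = trans (*-cong (f≈1 zero) (product-one (f≈1 ∘ suc))) (*-identityˡ 1#)

  product-cong : ∀ {n} {f g : Vector Carrier n} → (∀ i → f i ≈ g i) → product f ≈ product g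
  product-cong {zero}  f≈g = refl
  product-cong {suc n} f≈g = *-cong (f≈g zero) (product-cong (f≈g ∘ suc))

  product-* : ∀ {n} a (f : Vector Carrier n) → product (λ i → a * f i) ≈ a ^ n * product f
  product-* {zero}  a f = sym (*-identityˡ 1#)
  product-* {suc n} a f = trans (*-congˡ (product-* a (f ∘ suc)))
    (solve 4 (λ a x b p → a :* x :* (b :* p) := a :* b :* (x :* p)) refl a (f zero) (a ^ n) _)

  ^-+ : ∀ a m n → a ^ (m ℕ.+ n) ≈ a ^ m * a ^ n
  ^-+ a zero    n = sym (*-identityˡ _)
  ^-+ a (suc m) n = trans (*-congˡ (^-+ a m n)) (sym (*-assoc _ _ _))

  product-powers : ∀ a n → product {n} (λ i → a ^ toℕ i) ≈ a ^ (n C 2)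
  product-powers a zero    = refl
  product-powers a (suc n) = begin
    1# * product {n} (λ i → a * a ^ toℕ i)
      ≈⟨ *-identityˡ _ ⟩
    product {n} (λ i → a * a ^ toℕ i)
      ≈⟨ product-* {n} a (λ i → a ^ toℕ i) ⟩
    a ^ n * product {n} (λ i → a ^ toℕ i)
      ≈⟨ *-congˡ (product-powers a n) ⟩
    a ^ n * a ^ (n C 2)
      ≈⟨ ^-+ a n (n C 2) ⟨
    a ^ (n ℕ.+ n C 2)
      -- Written as `n C 1`, the new exponent is absorbed by Pascal's rule.
      ≡⟨ ≡.cong (λ m → a ^ (m ℕ.+ n C 2)) (nC1≡n n) ⟨
    a ^ (n C 1 ℕ.+ n C 2)
      ≡⟨ ≡.cong (a ^_) (nCk+nC[k+1]≡[n+1]C[k+1] n 1) ⟩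
    a ^ (suc n C 2) ∎

  -- Tridiagonal determinant and Motzkin moments

  module _ (t : Carrier) where

    -- The matrix of 1 + x in the basis of the monic orthogonal polynomials p_k of
    -- the moments C_(m+1)(t), for which x p_k = p_(k+1) + (1 + t) p_k + t p_(k-1).
    tridiagonal : ℕ → ℕ → Carrier
    tridiagonal zero          zero          = 1# + 1# + t
    tridiagonal zero          (suc zero)    = t
    tridiagonal zero          (suc (suc l)) = 0#
    tridiagonal (suc k)       (suc l)       = tridiagonal k l
    tridiagonal (suc zero)    zero          = 1#
    tridiagonal (suc (suc k)) zero          = 0#

    Tridiagonal : ∀ n → Matrix n
    Tridiagonal n i j = tridiagonal (toℕ i) (toℕ j)

    -- The last row of the truncated matrix has lost its superdiagonal entry. The vanishing of
    -- `g (suc n)` makes the lost term zero, so that row has the same formula as the others.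
    tridiagonal-row₀ : ∀ n (g : ℕ → Carrier) → g (suc n) ≈ 0# →
      ∑[ l < suc n ] (tridiagonal 0 (toℕ l) * g (toℕ l)) ≈ (1# + 1# + t) * g 0 + t * g 1
    tridiagonal-row₀ zero    g g≈0 = +-congˡ (sym (trans (*-congˡ g≈0) (zeroʳ t)))
    tridiagonal-row₀ (suc n) g g≈0 = +-congˡ
      (trans (+-congˡ (sum-zero {n} λ l → zeroˡ (g (suc (suc (toℕ l)))))) (+-identityʳ _))

    tridiagonal-row : ∀ n (g : ℕ → Carrier) k → k ℕ.< n → g (suc n) ≈ 0# →
      ∑[ l < suc n ] (tridiagonal (suc k) (toℕ l) * g (toℕ l)) ≈
        g k + ((1# + 1# + t) * g (suc k) + t * g (suc (suc k)))
    tridiagonal-row (suc n) g zero    k<n       g≈0 = +-cong (*-identityˡ _) (tridiagonal-row₀ n (g ∘ suc) g≈0)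
    tridiagonal-row (suc n) g (suc k) (s≤s k<n) g≈0 =
      trans (+-cong (zeroˡ _) (tridiagonal-row n (g ∘ suc) k k<n g≈0)) (+-identityˡ _)

    -- Row 0 has two nonzero entries. The minor of the first is the next smaller matrix; that of the
    -- second has a single 1 on top of its column 0, and expanding along this column leaves the
    -- matrix smaller by two.
    det-Tridiagonal-recurrence : ∀ n → ∣ Tridiagonal (suc (suc n)) ∣ ≈
      (1# + 1# + t) * ∣ Tridiagonal (suc n) ∣ + - 1# * t * ∣ Tridiagonal n ∣
    det-Tridiagonal-recurrence n = +-cong
      (*-congʳ (*-identityˡ _))
      (begin
        - 1# * 1# * t * ∣ minor ∣ + sum later
          ≈⟨ +-cong
               (*-cong (*-congʳ (*-identityʳ _)) (det-expand-column minor))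
               (sum-zero {f = later} λ j →
                 trans (*-congʳ {x = later-minor j} (zeroʳ _)) (zeroˡ _)) ⟩
        - 1# * t * (1# * 1# * ∣ Tridiagonal n ∣ + sum below) + 0#
          ≈⟨ +-identityʳ _ ⟩
        - 1# * t * (1# * 1# * ∣ Tridiagonal n ∣ + sum below)
          ≈⟨ *-congˡ (+-cong
               (trans (*-congʳ (*-identityˡ _)) (*-identityˡ _))
               (sum-zero {f = below} λ i →
                 trans (*-congʳ {x = ∣ columnMinor minor (suc i) ∣} (zeroʳ _)) (zeroˡ _))) ⟩
        - 1# * t * (∣ Tridiagonal n ∣ + 0#)
          ≈⟨ *-congˡ (+-identityʳ _) ⟩
        - 1# * t * ∣ Tridiagonal n ∣ ∎)
      where
      minor : Matrix (suc n)
      minor i k = Tridiagonal (suc (suc n)) (suc i) (punchIn (suc zero) k)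
      below : Vector Carrier n
      below i = sign (suc i) * minor (suc i) zero * ∣ columnMinor minor (suc i) ∣
      later-minor later : Vector Carrier n
      later-minor j = ∣ (λ i → removeAt (Tridiagonal (suc (suc n)) (suc i)) (suc (suc j))) ∣
      later j = sign (suc (suc j)) * 0# * later-minor j

    -- The factor (-1)^n flips the sign of the coefficient 2 + t in the recurrence and keeps that of
    -- -t, which gives the Fibonacci recurrence. `x` and `s` are free up to `≈` because the
    -- polynomial -t-2 may be written in a different form.
    det-Tridiagonal : ∀ x s → x ≈ - 1# * (1# + 1# + t) → s ≈ - 1# * t →
      ∀ n → ∣ Tridiagonal n ∣ ≈ (- 1#) ^ n * fib rawRing (suc n) x s
    det-Tridiagonal x s x≈ s≈ zero       = sym (*-identityˡ 1#)
    det-Tridiagonal x s x≈ s≈ (suc zero) = begin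
      1# * (1# + 1# + t) * 1# + 0#
        ≈⟨ solve 1 (λ a → con 1 :* a :* con 1 :+ con 0 := con 1 :* a) refl (1# + 1# + t) ⟩
      1# * (1# + 1# + t)
        ≈⟨ *-congʳ -1*-1≈1 ⟨
      - 1# * - 1# * (1# + 1# + t)
        ≈⟨ solve 3 (λ u a s → u :* u :* a := u :* con 1 :* (u :* a :* con 1 :+ s :* con 0)) refl (- 1#) (1# + 1# + t) s ⟩
      - 1# * 1# * (- 1# * (1# + 1# + t) * 1# + s * 0#)
        ≈⟨ *-congˡ (+-congʳ (*-congʳ x≈)) ⟨
      - 1# * 1# * (x * 1# + s * 0#) ∎
    det-Tridiagonal x s x≈ s≈ (suc (suc n)) = begin
      ∣ Tridiagonal (suc (suc n)) ∣
        ≈⟨ det-Tridiagonal-recurrence n ⟩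
      (1# + 1# + t) * ∣ Tridiagonal (suc n) ∣ + - 1# * t * ∣ Tridiagonal n ∣
        ≈⟨ +-cong (*-congˡ (det-Tridiagonal x s x≈ s≈ (suc n))) (*-congˡ (det-Tridiagonal x s x≈ s≈ n)) ⟩
      (1# + 1# + t) * (- 1# * ε * F₁) + - 1# * t * (ε * F₀)
        ≈⟨ +-congʳ (*-identityˡ _) ⟨
      1# * ((1# + 1# + t) * (- 1# * ε * F₁)) + - 1# * t * (ε * F₀)
        ≈⟨ +-cong (*-congʳ -1*-1≈1) (trans (*-congʳ -1*-1≈1) (trans (*-identityˡ _) (sym (*-assoc _ _ _)))) ⟨
      - 1# * - 1# * ((1# + 1# + t) * (- 1# * ε * F₁)) + - 1# * - 1# * (- 1# * (t * (ε * F₀)))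
        ≈⟨ solve 6 (λ u a t ε F₁ F₀ → u :* u :* (a :* (u :* ε :* F₁)) :+ u :* u :* (u :* (t :* (ε :* F₀)))
             := u :* (u :* ε) :* (u :* a :* F₁ :+ u :* t :* F₀))
             refl (- 1#) (1# + 1# + t) t ε F₁ F₀ ⟩
      - 1# * (- 1# * ε) * (- 1# * (1# + 1# + t) * F₁ + - 1# * t * F₀)
        ≈⟨ *-congˡ (+-cong (*-congʳ x≈) (*-congʳ s≈)) ⟨
      - 1# * (- 1# * ε) * (x * F₁ + s * F₀) ∎
      where
      ε F₁ F₀ : Carrier
      ε = (- 1#) ^ n
      F₁ = fib rawRing (suc (suc n)) x s
      F₀ = fib rawRing (suc n) x s

    -- Column k + 1 belongs to height k; column 0 is a zero boundary.
    motzkin : ℕ → ℕ → Carrier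
    motzkin zero    zero          = 0#
    motzkin zero    (suc zero)    = 1#
    motzkin zero    (suc (suc k)) = 0#
    motzkin (suc n) zero          = 0#
    motzkin (suc n) (suc k)       = motzkin n k + (1# + t) * motzkin n (suc k) + t * motzkin n (suc (suc k))

    motzkin-boundary : ∀ n → motzkin n 0 ≈ 0#
    motzkin-boundary zero    = refl
    motzkin-boundary (suc n) = refl

    motzkin-above : ∀ n k → suc n ℕ.< k → motzkin n k ≈ 0#
    motzkin-above zero    (suc zero)    (s≤s ())
    motzkin-above zero    (suc (suc k)) n<k       = refl
    motzkin-above (suc n) (suc k)       (s≤s n<k) = begin
      motzkin n k + (1# + t) * motzkin n (suc k) + t * motzkin n (suc (suc k))
        ≈⟨ +-cong (+-cong (motzkin-above n k n<k) (*-congˡ (motzkin-above n (suc k) (ℕ.m≤n⇒m≤1+n n<k))))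
                  (*-congˡ (motzkin-above n (suc (suc k)) (ℕ.m≤n⇒m≤1+n (ℕ.m≤n⇒m≤1+n n<k)))) ⟩
      0# + (1# + t) * 0# + t * 0#
        ≈⟨ solve 1 (λ t → con 0 :+ (con 1 :+ t) :* con 0 :+ t :* con 0 := con 0) refl t ⟩
      0# ∎

    motzkin-diagonal : ∀ n → motzkin n (suc n) ≈ 1#
    motzkin-diagonal zero    = refl
    motzkin-diagonal (suc n) = begin
      motzkin n (suc n) + (1# + t) * motzkin n (suc (suc n)) + t * motzkin n (suc (suc (suc n)))
        ≈⟨ +-cong (+-cong (motzkin-diagonal n) (*-congˡ (motzkin-above n (suc (suc n)) ℕ.≤-refl)))
                  (*-congˡ (motzkin-above n (suc (suc (suc n))) (ℕ.m≤n⇒m≤1+n ℕ.≤-refl))) ⟩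
      1# + (1# + t) * 0# + t * 0#
        ≈⟨ solve 1 (λ t → con 1 :+ (con 1 :+ t) :* con 0 :+ t :* con 0 := con 1) refl t ⟩
      1# ∎

    -- L(x^i x^j) in the orthogonal basis with norms t^k, cut off at height `N`.
    pairing : ℕ → ℕ → ℕ → Carrier
    pairing N i j = ∑[ k < N ] (t ^ toℕ k * motzkin i (suc (toℕ k)) * motzkin j (suc (toℕ k)))

    -- Multiplication by x is self-adjoint: the difference of the two sides telescopes.
    pairing-shift : ∀ N i j → i ℕ.< N → j ℕ.< N → pairing N (suc i) j ≈ pairing N i (suc j)
    pairing-shift N i j i<N j<N = begin
      pairing N (suc i) j
        ≈⟨ sum-cong {N} (λ k → solve 6 (λ t p a₀ a₁ a₂ b₁ →
             p :* (a₀ :+ (con 1 :+ t) :* a₁ :+ t :* a₂) :* b₁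
             := p :* a₀ :* b₁ :+ t :* p :* a₂ :* b₁ :+ p :* (con 1 :+ t) :* a₁ :* b₁)
             refl t (t ^ toℕ k) (a (toℕ k)) (a (suc (toℕ k))) (a (suc (suc (toℕ k)))) (b (suc (toℕ k)))) ⟩
      ∑[ k < N ] (U (toℕ k) + V (suc (toℕ k)) + D (toℕ k))
        ≈⟨ split U (V ∘ suc) ⟩
      ∑[ k < N ] U (toℕ k) + ∑[ k < N ] V (suc (toℕ k)) + ∑[ k < N ] D (toℕ k)
        ≈⟨ +-congʳ (+-cong (shift U U₀≈0 U_N≈0) (sym (shift V V₀≈0 V_N≈0))) ⟩
      ∑[ k < N ] U (suc (toℕ k)) + ∑[ k < N ] V (toℕ k) + ∑[ k < N ] D (toℕ k)
        ≈⟨ split (U ∘ suc) V ⟨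
      ∑[ k < N ] (U (suc (toℕ k)) + V (toℕ k) + D (toℕ k))
        ≈⟨ sum-cong {N} (λ k → solve 6 (λ t p a₁ b₀ b₁ b₂ →
             p :* a₁ :* (b₀ :+ (con 1 :+ t) :* b₁ :+ t :* b₂)
             := t :* p :* a₁ :* b₂ :+ p :* a₁ :* b₀ :+ p :* (con 1 :+ t) :* a₁ :* b₁)
             refl t (t ^ toℕ k) (a (suc (toℕ k))) (b (toℕ k)) (b (suc (toℕ k))) (b (suc (suc (toℕ k))))) ⟨
      pairing N i (suc j) ∎
      where
      a b U V D : ℕ → Carrier
      a = motzkin i
      b = motzkin j
      -- `U k` has row `i` at height k - 1 and row `j` at height k; `V k` is the reverse. A step
      -- added to path `i` contributes `U k` (up) and `V (suc k)` (down); added to path `j` it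
      -- contributes `V k` and `U (suc k)`. Level steps give `D k` on both sides.
      U k = t ^ k * a k * b (suc k)
      V k = t ^ k * a (suc k) * b k
      D k = t ^ k * (1# + t) * a (suc k) * b (suc k)
      split : (f g : ℕ → Carrier) → ∑[ k < N ] (f (toℕ k) + g (toℕ k) + D (toℕ k)) ≈
        ∑[ k < N ] f (toℕ k) + ∑[ k < N ] g (toℕ k) + ∑[ k < N ] D (toℕ k)
      split f g = trans (∑-distrib-+ {N} (λ k → f (toℕ k) + g (toℕ k)) (D ∘ toℕ))
        (+-congʳ (∑-distrib-+ {N} (f ∘ toℕ) (g ∘ toℕ)))
      shift : (f : ℕ → Carrier) → f 0 ≈ 0# → f N ≈ 0# → ∑[ k < N ] f (toℕ k) ≈ ∑[ k < N ] f (suc (toℕ k))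
      shift f f₀≈0 f_N≈0 = begin
        ∑[ k < N ] f (toℕ k)               ≈⟨ +-identityʳ _ ⟨
        ∑[ k < N ] f (toℕ k) + 0#          ≈⟨ +-congˡ f_N≈0 ⟨
        ∑[ k < N ] f (toℕ k) + f N         ≈⟨ ∑-shift N f ⟨
        f 0 + ∑[ k < N ] f (suc (toℕ k))   ≈⟨ +-congʳ f₀≈0 ⟩
        0# + ∑[ k < N ] f (suc (toℕ k))    ≈⟨ +-identityˡ _ ⟩
        ∑[ k < N ] f (suc (toℕ k))         ∎
      U₀≈0 : U 0 ≈ 0#
      U₀≈0 = trans (*-congʳ (trans (*-congˡ (motzkin-boundary i)) (zeroʳ _))) (zeroˡ _)
      V₀≈0 : V 0 ≈ 0#
      V₀≈0 = trans (*-congˡ (motzkin-boundary j)) (zeroʳ _)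
      U_N≈0 : U N ≈ 0#
      U_N≈0 = trans (*-congˡ (motzkin-above j (suc N) (s≤s j<N))) (zeroʳ _)
      V_N≈0 : V N ≈ 0#
      V_N≈0 = trans (*-congʳ (trans (*-congˡ (motzkin-above i (suc N) (s≤s i<N))) (zeroʳ _))) (zeroˡ _)

    -- Steps move one by one from `i` to `j` until the first path is empty and only height 0
    -- remains. The bound on the total length keeps both paths below `N` at each move.
    pairing-moment : ∀ N i j → i ℕ.+ j ℕ.< N → pairing N i j ≈ motzkin (i ℕ.+ j) 1
    pairing-moment (suc N) zero    j i+j<N = begin
      1# * 1# * motzkin j 1 + ∑[ k < N ] (t ^ suc (toℕ k) * 0# * motzkin j (suc (suc (toℕ k))))
        ≈⟨ +-cong (trans (*-congʳ (*-identityˡ 1#)) (*-identityˡ _))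
                  (sum-zero {N} λ k → trans (*-congʳ {x = motzkin j (suc (suc (toℕ k)))} (zeroʳ _)) (zeroˡ _)) ⟩
      motzkin j 1 + 0#
        ≈⟨ +-identityʳ _ ⟩
      motzkin j 1 ∎
    pairing-moment N       (suc i) j i+j<N = begin
      pairing N (suc i) j
        ≈⟨ pairing-shift N i j (ℕ.≤-trans (s≤s (ℕ.≤-trans (ℕ.m≤m+n i j) (ℕ.n≤1+n _))) i+j<N)
                               (ℕ.≤-trans (s≤s (ℕ.≤-trans (ℕ.m≤n+m j i) (ℕ.n≤1+n _))) i+j<N) ⟩
      pairing N i (suc j)
        ≈⟨ pairing-moment N i (suc j) (≡.subst (ℕ._< N) (≡.sym (ℕ.+-suc i j)) i+j<N) ⟩
      motzkin (i ℕ.+ suc j) 1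
        ≡⟨ ≡.cong (λ m → motzkin m 1) (ℕ.+-suc i j) ⟩
      motzkin (suc i ℕ.+ j) 1 ∎

    -- A path of length `i` below `n` never reaches height `n`, however long the other path is.
    pairing-truncate : ∀ n m i j → i ℕ.< n → pairing (n ℕ.+ m) i j ≈ pairing n i j
    pairing-truncate n m i j i<n = ∑-truncate n m (λ k → t ^ k * motzkin i (suc k) * motzkin j (suc k)) λ k n≤k →
      trans (*-congʳ (trans (*-congˡ (motzkin-above i (suc k) (s≤s (ℕ.≤-trans i<n n≤k)))) (zeroʳ _))) (zeroˡ _)

    -- Multiplication by 1 + x on row `j`: the recurrence of `motzkin` with an extra 1 on the
    -- diagonal. Since `j` is below `n`, the entry at height `n` that the truncated sum omits is
    -- zero.
    tridiagonal-motzkin : ∀ n k j → k ℕ.< n → j ℕ.< n →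
      ∑[ l < n ] (tridiagonal k (toℕ l) * motzkin j (suc (toℕ l))) ≈
        motzkin j (suc k) + motzkin (suc j) (suc k)
    tridiagonal-motzkin (suc n) zero j k<n j<n = begin
      ∑[ l < suc n ] (tridiagonal zero (toℕ l) * motzkin j (suc (toℕ l)))
        ≈⟨ tridiagonal-row₀ n (motzkin j ∘ suc) (motzkin-above j (suc (suc n)) (s≤s j<n)) ⟩
      (1# + 1# + t) * b₁ + t * b₂
        ≈⟨ solve 3 (λ t b₁ b₂ → (con 1 :+ con 1 :+ t) :* b₁ :+ t :* b₂
             := b₁ :+ (con 0 :+ (con 1 :+ t) :* b₁ :+ t :* b₂)) refl t b₁ b₂ ⟩
      b₁ + (0# + (1# + t) * b₁ + t * b₂)
        ≈⟨ +-congˡ (+-congʳ (+-congʳ (motzkin-boundary j))) ⟨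
      motzkin j 1 + motzkin (suc j) 1 ∎
      where
      b₁ b₂ : Carrier
      b₁ = motzkin j 1
      b₂ = motzkin j 2
    tridiagonal-motzkin (suc n) (suc k) j (s≤s k<n) j<n = trans
      (tridiagonal-row n (motzkin j ∘ suc) k k<n (motzkin-above j (suc (suc n)) (s≤s j<n)))
      (solve 4 (λ t b₀ b₁ b₂ → b₀ :+ ((con 1 :+ con 1 :+ t) :* b₁ :+ t :* b₂)
         := b₁ :+ (b₀ :+ (con 1 :+ t) :* b₁ :+ t :* b₂))
         refl t (motzkin j (suc k)) (motzkin j (suc (suc k))) (motzkin j (suc (suc (suc k)))))

    -- Factorization of the moment matrix

    Motzkin : ∀ n → Matrix n
    Motzkin n i k = motzkin (toℕ i) (suc (toℕ k))

    moment-factorization : ∀ n (i j : Fin n) →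
      motzkin (toℕ i ℕ.+ toℕ j) 1 + motzkin (toℕ i ℕ.+ suc (toℕ j)) 1 ≈
        ∑[ k < n ] (t ^ toℕ k * Motzkin n i k * ∑[ l < n ] (Tridiagonal n k l * Motzkin n j l))
    moment-factorization n i j = begin
      motzkin (i′ ℕ.+ j′) 1 + motzkin (i′ ℕ.+ suc j′) 1
        ≈⟨ +-cong (pairing-moment N i′ j′ (ℕ.≤-trans (s≤s (ℕ.+-monoʳ-≤ i′ (ℕ.n≤1+n j′))) bound))
                  (pairing-moment N i′ (suc j′) bound) ⟨
      pairing N i′ j′ + pairing N i′ (suc j′)
        ≈⟨ +-cong (pairing-truncate n (suc j′) i′ j′ (toℕ<n i)) (pairing-truncate n (suc j′) i′ (suc j′) (toℕ<n i)) ⟩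
      pairing n i′ j′ + pairing n i′ (suc j′)
        ≈⟨ ∑-distrib-+ {n} (λ k → w k * motzkin j′ (suc (toℕ k))) (λ k → w k * motzkin (suc j′) (suc (toℕ k))) ⟨
      ∑[ k < n ] (w k * motzkin j′ (suc (toℕ k)) + w k * motzkin (suc j′) (suc (toℕ k)))
        ≈⟨ sum-cong {n} (λ k → trans (sym (distribˡ (w k) _ _))
             (*-congˡ {x = w k} (sym (tridiagonal-motzkin n (toℕ k) j′ (toℕ<n k) (toℕ<n j))))) ⟩
      ∑[ k < n ] (w k * ∑[ l < n ] (Tridiagonal n k l * Motzkin n j l)) ∎
      where
      i′ j′ N : ℕ
      i′ = toℕ i
      j′ = toℕ j
      -- Above the total length of both pairs of paths, and of the form needed to cut back to `n`.
      N = n ℕ.+ suc j′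
      bound : i′ ℕ.+ suc j′ ℕ.< N
      bound = ℕ.+-monoˡ-≤ (suc j′) (toℕ<n i)
      w : Fin n → Carrier
      w k = t ^ toℕ k * Motzkin n i k

    det-moments : ∀ n →
      ∣ (λ (i j : Fin n) → motzkin (toℕ i ℕ.+ toℕ j) 1 + motzkin (toℕ i ℕ.+ suc (toℕ j)) 1) ∣ ≈
        t ^ (n C 2) * ∣ Tridiagonal n ∣
    det-moments n = begin
      ∣ (λ (i j : Fin n) → motzkin (toℕ i ℕ.+ toℕ j) 1 + motzkin (toℕ i ℕ.+ suc (toℕ j)) 1) ∣
        ≈⟨ det-cong _ (λ i j → ∑[ k < n ] (L i k * X k j)) (moment-factorization n) ⟩
      ∣ (λ i j → ∑[ k < n ] (L i k * X k j)) ∣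
        ≈⟨ det-lower-triangular-* L X (λ i k i<k → trans (*-congˡ (above i k i<k)) (zeroʳ _)) ⟩
      product (λ i → L i i) * ∣ X ∣
        ≈⟨ *-cong
             (trans (product-cong {n} (λ i → trans (*-congˡ (motzkin-diagonal (toℕ i))) (*-identityʳ _)))
                    (product-powers t n))
             det-X ⟩
      t ^ (n C 2) * ∣ Tridiagonal n ∣ ∎
      where
      L X : Matrix n
      L i k = t ^ toℕ k * Motzkin n i k
      X k j = ∑[ l < n ] (Tridiagonal n k l * Motzkin n j l)
      above : ∀ i k → toℕ i ℕ.< toℕ k → Motzkin n i k ≈ 0#
      above i k i<k = motzkin-above (toℕ i) (suc (toℕ k)) (s≤s i<k)
      -- The unitriangular factor of `X` stands on the right; transposition brings it to the left.
      det-X : ∣ X ∣ ≈ ∣ Tridiagonal n ∣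
      det-X = begin
        ∣ X ∣
          ≈⟨ det-transpose X ⟨
        ∣ (λ j k → X k j) ∣
          ≈⟨ det-cong (λ j k → X k j) (λ j k → ∑[ l < n ] (Motzkin n j l * Tridiagonal n k l))
               (λ j k → sum-cong {n} λ l → *-comm (Tridiagonal n k l) (Motzkin n j l)) ⟩
        ∣ (λ j k → ∑[ l < n ] (Motzkin n j l * Tridiagonal n k l)) ∣
          ≈⟨ det-lower-triangular-* (Motzkin n) (λ l k → Tridiagonal n k l) above ⟩
        product (λ i → Motzkin n i i) * ∣ (λ l k → Tridiagonal n k l) ∣
          ≈⟨ *-cong (product-one {n} (λ i → motzkin-diagonal (toℕ i))) (det-transpose (Tridiagonal n)) ⟩
        1# * ∣ Tridiagonal n ∣
          ≈⟨ *-identityˡ _ ⟩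
        ∣ Tridiagonal n ∣ ∎

open import Data.List.Base using ([]; _∷_; map)
open import Defs
open _≈_ using (coeff-≡)

-- The commutative ring ℚ[t]

infixr 7 _·_
_·_ : ℚ → Poly → Poly
a · p = map (a ℚ.*_) p

coeff-+ : ∀ p q k → coeff (p + q) k ≡ coeff p k ℚ.+ coeff q k
coeff-+ []      q       k       = ≡.sym (ℚ.+-identityˡ _)
coeff-+ (a ∷ p) []      k       = ≡.sym (ℚ.+-identityʳ _)
coeff-+ (a ∷ p) (b ∷ q) zero    = ≡.refl
coeff-+ (a ∷ p) (b ∷ q) (suc k) = coeff-+ p q k

coeff-- : ∀ p k → coeff (- p) k ≡ ℚ.- coeff p k
coeff-- []      k       = ≡.refl
coeff-- (a ∷ p) zero    = ≡.refl
coeff-- (a ∷ p) (suc k) = coeff-- p k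

coeff-· : ∀ a p k → coeff (a · p) k ≡ a ℚ.* coeff p k
coeff-· a []      k       = ≡.sym (ℚ.*-zeroʳ a)
coeff-· a (b ∷ p) zero    = ≡.refl
coeff-· a (b ∷ p) (suc k) = coeff-· a p k

≈-refl : ∀ {p} → p ≈ p
≈-refl = mk≈ λ k → ≡.refl

≈-sym : ∀ {p q} → p ≈ q → q ≈ p
≈-sym p≈q = mk≈ λ k → ≡.sym (coeff-≡ p≈q k)

≈-trans : ∀ {p q r} → p ≈ q → q ≈ r → p ≈ r
≈-trans p≈q q≈r = mk≈ λ k → ≡.trans (coeff-≡ p≈q k) (coeff-≡ q≈r k)

∷-cong : ∀ {a b p q} → a ≡ b → p ≈ q → a ∷ p ≈ b ∷ q
∷-cong a≡b p≈q = mk≈ λ { zero → a≡b ; (suc k) → coeff-≡ p≈q k }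

0∷[]≈[] : 0ℚ ∷ [] ≈ []
0∷[]≈[] = mk≈ λ { zero → ≡.refl ; (suc k) → ≡.refl }

+-cong : ∀ {p p′ q q′} → p ≈ p′ → q ≈ q′ → p + q ≈ p′ + q′
+-cong {p} {p′} {q} {q′} p≈p′ q≈q′ = mk≈ λ k → begin
  coeff (p + q) k            ≡⟨ coeff-+ p q k ⟩
  coeff p k ℚ.+ coeff q k    ≡⟨ ≡.cong₂ ℚ._+_ (coeff-≡ p≈p′ k) (coeff-≡ q≈q′ k) ⟩
  coeff p′ k ℚ.+ coeff q′ k  ≡⟨ coeff-+ p′ q′ k ⟨
  coeff (p′ + q′) k          ∎
  where open ≡.≡-Reasoning

+-assoc : ∀ p q r → (p + q) + r ≈ p + (q + r)
+-assoc p q r = mk≈ λ k → begin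
  coeff ((p + q) + r) k                    ≡⟨ coeff-+ (p + q) r k ⟩
  coeff (p + q) k ℚ.+ coeff r k            ≡⟨ ≡.cong (ℚ._+ coeff r k) (coeff-+ p q k) ⟩
  coeff p k ℚ.+ coeff q k ℚ.+ coeff r k    ≡⟨ ℚ.+-assoc (coeff p k) (coeff q k) (coeff r k) ⟩
  coeff p k ℚ.+ (coeff q k ℚ.+ coeff r k)  ≡⟨ ≡.cong (coeff p k ℚ.+_) (coeff-+ q r k) ⟨
  coeff p k ℚ.+ coeff (q + r) k            ≡⟨ coeff-+ p (q + r) k ⟨
  coeff (p + (q + r)) k                    ∎
  where open ≡.≡-Reasoning

+-comm : ∀ p q → p + q ≈ q + p
+-comm p q = mk≈ λ k → begin
  coeff (p + q) k          ≡⟨ coeff-+ p q k ⟩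
  coeff p k ℚ.+ coeff q k  ≡⟨ ℚ.+-comm (coeff p k) (coeff q k) ⟩
  coeff q k ℚ.+ coeff p k  ≡⟨ coeff-+ q p k ⟨
  coeff (q + p) k          ∎
  where open ≡.≡-Reasoning

+-identityʳ : ∀ p → p + [] ≈ p
+-identityʳ p = +-comm p []

-‿cong : ∀ {p q} → p ≈ q → - p ≈ - q
-‿cong {p} {q} p≈q = mk≈ λ k →
  ≡.trans (coeff-- p k) (≡.trans (≡.cong ℚ.-_ (coeff-≡ p≈q k)) (≡.sym (coeff-- q k)))

-‿inverseʳ : ∀ p → p + (- p) ≈ []
-‿inverseʳ p = mk≈ λ k → ≡.trans (coeff-+ p (- p) k)
  (≡.trans (≡.cong (coeff p k ℚ.+_) (coeff-- p k)) (ℚ.+-inverseʳ (coeff p k)))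

+-isAbelianGroup : IsAbelianGroup _≈_ _+_ [] (-_)
+-isAbelianGroup = record
  { isGroup = record
    { isMonoid = record
      { isSemigroup = record
        { isMagma = record
          { isEquivalence = record { refl = ≈-refl ; sym = ≈-sym ; trans = ≈-trans }
          ; ∙-cong = +-cong
          }
        ; assoc = +-assoc
        }
      ; identity = (λ p → ≈-refl) , +-identityʳ
      }
    ; inverse = (λ p → ≈-trans (+-comm (- p) p) (-‿inverseʳ p)) , -‿inverseʳ
    ; ⁻¹-cong = -‿cong
    }
  ; comm = +-comm
  }

+-abelianGroup : AbelianGroup 0ℓ 0ℓ
+-abelianGroup = record { isAbelianGroup = +-isAbelianGroup }

module ≈-Reasoning = SetoidReasoning (AbelianGroup.setoid +-abelianGroup)
open import Algebra.Properties.CommutativeSemigroup (AbelianGroup.commutativeSemigroup +-abelianGroup)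
  using (interchange; x∙yz≈y∙xz)

-- Scalar multiples and products of polynomials

·-cong : ∀ a {p q} → p ≈ q → a · p ≈ a · q
·-cong a {p} {q} p≈q = mk≈ λ k →
  ≡.trans (coeff-· a p k) (≡.trans (≡.cong (a ℚ.*_) (coeff-≡ p≈q k)) (≡.sym (coeff-· a q k)))

·-identity : ∀ p → 1ℚ · p ≈ p
·-identity p = mk≈ λ k → ≡.trans (coeff-· 1ℚ p k) (ℚ.*-identityˡ (coeff p k))

·-zero : ∀ p → 0ℚ · p ≈ []
·-zero p = mk≈ λ k → ≡.trans (coeff-· 0ℚ p k) (ℚ.*-zeroˡ (coeff p k))

·-assoc : ∀ a b p → (a ℚ.* b) · p ≈ a · (b · p)
·-assoc a b []      = ≈-refl
·-assoc a b (c ∷ p) = ∷-cong (ℚ.*-assoc a b c) (·-assoc a b p)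

·-distrib-+ : ∀ a p q → a · (p + q) ≈ a · p + a · q
·-distrib-+ a []      q       = ≈-refl
·-distrib-+ a (b ∷ p) []      = ≈-refl
·-distrib-+ a (b ∷ p) (c ∷ q) = ∷-cong (ℚ.*-distribˡ-+ a b c) (·-distrib-+ a p q)

*-zeroʳ : ∀ p → p * [] ≈ []
*-zeroʳ []      = ≈-refl
*-zeroʳ (a ∷ p) = ≈-trans (∷-cong ≡.refl (*-zeroʳ p)) 0∷[]≈[]

*-congˡ : ∀ p {q q′} → q ≈ q′ → p * q ≈ p * q′
*-congˡ []      q≈q′ = ≈-refl
*-congˡ (a ∷ p) q≈q′ = +-cong (·-cong a q≈q′) (∷-cong ≡.refl (*-congˡ p q≈q′))

*-distribˡ-+ : ∀ p q r → p * (q + r) ≈ p * q + p * r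
*-distribˡ-+ []      q r = ≈-refl
*-distribˡ-+ (a ∷ p) q r = begin
  a · (q + r) + (0ℚ ∷ p * (q + r))
    ≈⟨ +-cong (·-distrib-+ a q r) (∷-cong ≡.refl (*-distribˡ-+ p q r)) ⟩
  (a · q + a · r) + ((0ℚ ∷ p * q) + (0ℚ ∷ p * r))
    ≈⟨ interchange (a · q) (a · r) (0ℚ ∷ p * q) (0ℚ ∷ p * r) ⟩
  (a · q + (0ℚ ∷ p * q)) + (a · r + (0ℚ ∷ p * r)) ∎
  where open ≈-Reasoning

-- The mirror image of the recursion that defines `_*_`; commutativity follows from the two
-- together.
*-∷ʳ : ∀ p b q → p * (b ∷ q) ≈ b · p + (0ℚ ∷ p * q)
*-∷ʳ []      b q = ≈-sym 0∷[]≈[]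
*-∷ʳ (a ∷ p) b q = ∷-cong (≡.cong (ℚ._+ 0ℚ) (ℚ.*-comm a b))
  (≈-trans (+-cong (≈-refl {a · q}) (*-∷ʳ p b q)) (x∙yz≈y∙xz (a · q) (b · p) (0ℚ ∷ p * q)))

*-comm : ∀ p q → p * q ≈ q * p
*-comm []      q = ≈-sym (*-zeroʳ q)
*-comm (a ∷ p) q = ≈-trans (+-cong (≈-refl {a · q}) (∷-cong ≡.refl (*-comm p q))) (≈-sym (*-∷ʳ q a p))

-- `_*_` recurses on its left factor, whose length `≈` does not fix, so congruence there is borrowed
-- from the right factor through commutativity.
*-cong : ∀ {p p′ q q′} → p ≈ p′ → q ≈ q′ → p * q ≈ p′ * q′
*-cong {p} {p′} {q} {q′} p≈p′ q≈q′ = begin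
  p * q    ≈⟨ *-congˡ p q≈q′ ⟩
  p * q′   ≈⟨ *-comm p q′ ⟩
  q′ * p   ≈⟨ *-congˡ q′ p≈p′ ⟩
  q′ * p′  ≈⟨ *-comm q′ p′ ⟩
  p′ * q′  ∎
  where open ≈-Reasoning

*-distribʳ-+ : ∀ p q r → (q + r) * p ≈ q * p + r * p
*-distribʳ-+ p q r = begin
  (q + r) * p    ≈⟨ *-comm (q + r) p ⟩
  p * (q + r)    ≈⟨ *-distribˡ-+ p q r ⟩
  p * q + p * r  ≈⟨ +-cong (*-comm p q) (*-comm p r) ⟩
  q * p + r * p  ∎
  where open ≈-Reasoning

·-*-assoc : ∀ a p q → (a · p) * q ≈ a · (p * q)
·-*-assoc a []      q = ≈-refl
·-*-assoc a (b ∷ p) q = begin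
  (a ℚ.* b) · q + (0ℚ ∷ (a · p) * q)
    ≈⟨ +-cong (·-assoc a b q) (∷-cong (≡.sym (ℚ.*-zeroʳ a)) (·-*-assoc a p q)) ⟩
  a · (b · q) + a · (0ℚ ∷ p * q)
    ≈⟨ ·-distrib-+ a (b · q) (0ℚ ∷ p * q) ⟨
  a · (b · q + (0ℚ ∷ p * q)) ∎
  where open ≈-Reasoning

0∷-* : ∀ p q → (0ℚ ∷ p) * q ≈ 0ℚ ∷ p * q
0∷-* p q = +-cong (·-zero q) (≈-refl {0ℚ ∷ p * q})

*-assoc : ∀ p q r → (p * q) * r ≈ p * (q * r)
*-assoc []      q r = ≈-refl
*-assoc (a ∷ p) q r = begin
  (a · q + (0ℚ ∷ p * q)) * r
    ≈⟨ *-distribʳ-+ r (a · q) (0ℚ ∷ p * q) ⟩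
  (a · q) * r + (0ℚ ∷ p * q) * r
    ≈⟨ +-cong (·-*-assoc a q r) (≈-trans (0∷-* (p * q) r) (∷-cong ≡.refl (*-assoc p q r))) ⟩
  a · (q * r) + (0ℚ ∷ p * (q * r)) ∎
  where open ≈-Reasoning

const-* : ∀ a p → const a * p ≈ a · p
const-* a p = ≈-trans (+-cong (≈-refl {a · p}) 0∷[]≈[]) (+-identityʳ (a · p))

*-identityˡ : ∀ p → const 1ℚ * p ≈ p
*-identityˡ p = ≈-trans (const-* 1ℚ p) (·-identity p)

t-* : ∀ p → t * p ≈ 0ℚ ∷ p
t-* p = ≈-trans (0∷-* (const 1ℚ) p) (∷-cong ≡.refl (*-identityˡ p))

polyRing : CommutativeRing 0ℓ 0ℓ
polyRing = record
  { isCommutativeRing = record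
    { isRing = record
      { +-isAbelianGroup = +-isAbelianGroup
      ; *-cong = *-cong
      ; *-assoc = *-assoc
      ; *-identity = *-identityˡ , λ p → ≈-trans (*-comm p (const 1ℚ)) (*-identityˡ p)
      ; distrib = *-distribˡ-+ , *-distribʳ-+
      }
    ; *-comm = *-comm
    }
  }

-- Coefficients of Motzkin and Narayana polynomials

-- pascal n (k + 2) is the binomial coefficient n C k; the two leading zeros
-- make the recurrence uniform.
pascal : ℕ → ℕ → ℤ
pascal zero    (suc (suc zero)) = ℤ.1ℤ
pascal zero    _                = ℤ.0ℤ
pascal (suc n) zero             = ℤ.0ℤ
pascal (suc n) (suc i)          = pascal n i ℤ.+ pascal n (suc i)

pascal-0 : ∀ n → pascal n 0 ≡ ℤ.0ℤ
pascal-0 zero    = ≡.refl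
pascal-0 (suc n) = ≡.refl

pascal-1 : ∀ n → pascal n 1 ≡ ℤ.0ℤ
pascal-1 zero    = ≡.refl
pascal-1 (suc n) = ≡.cong₂ ℤ._+_ (pascal-0 n) (pascal-1 n)

nC0≡1 : ∀ n → n C 0 ≡ 1
nC0≡1 n = ≡.trans (nCk≡nC[n∸k] {n = n} z≤n) (nCn≡1 n)

pascal-C : ∀ n k → pascal n (suc (suc k)) ≡ + (n C k)
pascal-C zero    zero    = ≡.refl
pascal-C zero    (suc k) = ≡.cong +_ (≡.sym (k>n⇒nCk≡0 {0} {suc k} (s≤s z≤n)))
pascal-C (suc n) zero    = ≡.trans (≡.cong₂ ℤ._+_ (pascal-1 n) (pascal-C n 0))
  (≡.cong +_ (≡.trans (nC0≡1 n) (≡.sym (nC0≡1 (suc n)))))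
pascal-C (suc n) (suc k) = ≡.trans (≡.cong₂ ℤ._+_ (pascal-C n k) (pascal-C n (suc k)))
  (≡.cong +_ (nCk+nC[k+1]≡[n+1]C[k+1] n k))

-- The absorption rule i C(n,i) = (n - i + 1) C(n,i-1), arranged so that Pascal's rule derives row n
-- + 1 from the instances i and i + 1 in row n.
pascal-absorption : ∀ n i →
  + i ℤ.* pascal n (2 ℕ.+ i) ℤ.+ (+ i ℤ.- ℤ.1ℤ) ℤ.* pascal n (1 ℕ.+ i) ≡ + n ℤ.* pascal n (1 ℕ.+ i)
pascal-absorption zero    zero          = ≡.refl
pascal-absorption zero    (suc zero)    = ≡.refl
pascal-absorption zero    (suc (suc i)) = zeros (+ suc (suc i)) (+ suc i)
  where
  zeros : ∀ a b → a ℤ.* ℤ.0ℤ ℤ.+ b ℤ.* ℤ.0ℤ ≡ ℤ.0ℤ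
  zeros = solve-∀
pascal-absorption (suc n) zero
  rewrite pascal-0 n | pascal-1 n = ≡.sym (ℤ.*-zeroʳ (+ suc n))
pascal-absorption (suc n) (suc i) =
  step (+ i) (+ n) (pascal n (1 ℕ.+ i)) (pascal n (2 ℕ.+ i)) (pascal n (3 ℕ.+ i))
    (pascal-absorption n i) (pascal-absorption n (suc i))
  where
  step : ∀ i n p₁ p₂ p₃ → i ℤ.* p₂ ℤ.+ (i ℤ.- ℤ.1ℤ) ℤ.* p₁ ≡ n ℤ.* p₁ →
    (ℤ.1ℤ ℤ.+ i) ℤ.* p₃ ℤ.+ (ℤ.1ℤ ℤ.+ i ℤ.- ℤ.1ℤ) ℤ.* p₂ ≡ n ℤ.* p₂ →
    (ℤ.1ℤ ℤ.+ i) ℤ.* (p₂ ℤ.+ p₃) ℤ.+ (ℤ.1ℤ ℤ.+ i ℤ.- ℤ.1ℤ) ℤ.* (p₁ ℤ.+ p₂) ≡ (ℤ.1ℤ ℤ.+ n) ℤ.* (p₁ ℤ.+ p₂)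
  step i n p₁ p₂ p₃ h₁ h₂ = ≡.trans (before i p₁ p₂ p₃)
    (≡.trans (≡.cong₂ (λ x y → x ℤ.+ y ℤ.+ (p₁ ℤ.+ p₂)) h₁ h₂) (after n p₁ p₂))
    where
    before : ∀ i p₁ p₂ p₃ →
      (ℤ.1ℤ ℤ.+ i) ℤ.* (p₂ ℤ.+ p₃) ℤ.+ (ℤ.1ℤ ℤ.+ i ℤ.- ℤ.1ℤ) ℤ.* (p₁ ℤ.+ p₂) ≡
      (i ℤ.* p₂ ℤ.+ (i ℤ.- ℤ.1ℤ) ℤ.* p₁) ℤ.+ ((ℤ.1ℤ ℤ.+ i) ℤ.* p₃ ℤ.+ (ℤ.1ℤ ℤ.+ i ℤ.- ℤ.1ℤ) ℤ.* p₂) ℤ.+ (p₁ ℤ.+ p₂)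
    before = solve-∀
    after : ∀ n p₁ p₂ → n ℤ.* p₁ ℤ.+ n ℤ.* p₂ ℤ.+ (p₁ ℤ.+ p₂) ≡ (ℤ.1ℤ ℤ.+ n) ℤ.* (p₁ ℤ.+ p₂)
    after = solve-∀

-- The coefficient of t^(i-1) in motzkin n k, a 2 × 2 minor of Pascal's triangle
-- by the reflection principle.
motzkinCoeff : ℕ → ℕ → ℕ → ℤ
motzkinCoeff n k i =
  pascal n (1 ℕ.+ i) ℤ.* pascal n (k ℕ.+ i) ℤ.- pascal n i ℤ.* pascal n (1 ℕ.+ (k ℕ.+ i))

motzkinCoeff-0 : ∀ n k → motzkinCoeff n k 0 ≡ ℤ.0ℤ
motzkinCoeff-0 n k rewrite pascal-0 n | pascal-1 n = ≡.refl

motzkinCoeff-boundary : ∀ n i → motzkinCoeff n 0 i ≡ ℤ.0ℤ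
motzkinCoeff-boundary n i = cancel (pascal n (suc i)) (pascal n i)
  where
  cancel : ∀ a b → a ℤ.* b ℤ.- b ℤ.* a ≡ ℤ.0ℤ
  cancel = solve-∀

-- The Motzkin recurrence on coefficients: up step, level step of weight 1, level step of weight t,
-- down step. Each weight t lowers the index by one. Pascal's rule in all four entries of the minor
-- reduces it to a polynomial identity.
motzkinCoeff-step : ∀ n k i → motzkinCoeff (suc n) (suc k) (suc i) ≡
  motzkinCoeff n k (suc i) ℤ.+ (motzkinCoeff n (suc k) (suc i) ℤ.+ motzkinCoeff n (suc k) i) ℤ.+
    motzkinCoeff n (suc (suc k)) i
motzkinCoeff-step n k i rewrite ℕ.+-suc k i =
  identity (pascal n i) (pascal n (1 ℕ.+ i)) (pascal n (2 ℕ.+ i))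
    (pascal n (1 ℕ.+ (k ℕ.+ i))) (pascal n (2 ℕ.+ (k ℕ.+ i))) (pascal n (3 ℕ.+ (k ℕ.+ i)))
  where
  identity : ∀ a b c x y z →
    (b ℤ.+ c) ℤ.* (x ℤ.+ y) ℤ.- (a ℤ.+ b) ℤ.* (y ℤ.+ z) ≡
    (c ℤ.* x ℤ.- b ℤ.* y) ℤ.+ ((c ℤ.* y ℤ.- b ℤ.* z) ℤ.+ (b ℤ.* x ℤ.- a ℤ.* y)) ℤ.+ (b ℤ.* y ℤ.- a ℤ.* z)
  identity = solve-∀

-- The minor is C(m,j)^2 - C(m,j-1) C(m,j+1). After multiplication by j + 1, absorption at j + 1
-- removes C(m,j+1) in favour of m, and absorption at j removes m; C(m+1,j) C(m,j) is left.
motzkinCoeff-narayana : ∀ m j →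
  motzkinCoeff m 1 (suc j) ℤ.* + suc j ≡ + ((suc m C j) ℕ.* (m C j))
motzkinCoeff-narayana m j = begin
  (p₂ ℤ.* p₂ ℤ.- p₁ ℤ.* p₃) ℤ.* + suc j
    ≡⟨ before (+ j) p₁ p₂ p₃ ⟩
  (ℤ.1ℤ ℤ.+ + j) ℤ.* (p₂ ℤ.* p₂) ℤ.- p₁ ℤ.* ((ℤ.1ℤ ℤ.+ + j) ℤ.* p₃ ℤ.+ (ℤ.1ℤ ℤ.+ + j ℤ.- ℤ.1ℤ) ℤ.* p₂) ℤ.+ + j ℤ.* (p₁ ℤ.* p₂)
    ≡⟨ ≡.cong (λ x → (ℤ.1ℤ ℤ.+ + j) ℤ.* (p₂ ℤ.* p₂) ℤ.- p₁ ℤ.* x ℤ.+ + j ℤ.* (p₁ ℤ.* p₂)) (pascal-absorption m (suc j)) ⟩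
  (ℤ.1ℤ ℤ.+ + j) ℤ.* (p₂ ℤ.* p₂) ℤ.- p₁ ℤ.* (+ m ℤ.* p₂) ℤ.+ + j ℤ.* (p₁ ℤ.* p₂)
    ≡⟨ middle (+ j) (+ m) p₁ p₂ ⟩
  (ℤ.1ℤ ℤ.+ + j) ℤ.* (p₂ ℤ.* p₂) ℤ.- p₂ ℤ.* (+ m ℤ.* p₁) ℤ.+ + j ℤ.* (p₁ ℤ.* p₂)
    ≡⟨ ≡.cong (λ x → (ℤ.1ℤ ℤ.+ + j) ℤ.* (p₂ ℤ.* p₂) ℤ.- p₂ ℤ.* x ℤ.+ + j ℤ.* (p₁ ℤ.* p₂)) (pascal-absorption m j) ⟨
  (ℤ.1ℤ ℤ.+ + j) ℤ.* (p₂ ℤ.* p₂) ℤ.- p₂ ℤ.* (+ j ℤ.* p₂ ℤ.+ (+ j ℤ.- ℤ.1ℤ) ℤ.* p₁) ℤ.+ + j ℤ.* (p₁ ℤ.* p₂)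
    ≡⟨ after (+ j) p₁ p₂ ⟩
  (p₁ ℤ.+ p₂) ℤ.* p₂
    ≡⟨ ≡.cong₂ ℤ._*_ (pascal-C (suc m) j) (pascal-C m j) ⟩
  + (suc m C j) ℤ.* + (m C j)
    ≡⟨ ℤ.pos-* (suc m C j) (m C j) ⟨
  + ((suc m C j) ℕ.* (m C j)) ∎
  where
  open ≡.≡-Reasoning
  p₁ p₂ p₃ : ℤ
  p₁ = pascal m (1 ℕ.+ j)
  p₂ = pascal m (2 ℕ.+ j)
  p₃ = pascal m (3 ℕ.+ j)
  before : ∀ i a b c → (b ℤ.* b ℤ.- a ℤ.* c) ℤ.* (ℤ.1ℤ ℤ.+ i) ≡
    (ℤ.1ℤ ℤ.+ i) ℤ.* (b ℤ.* b) ℤ.- a ℤ.* ((ℤ.1ℤ ℤ.+ i) ℤ.* c ℤ.+ (ℤ.1ℤ ℤ.+ i ℤ.- ℤ.1ℤ) ℤ.* b) ℤ.+ i ℤ.* (a ℤ.* b)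
  before = solve-∀
  middle : ∀ i n a b → (ℤ.1ℤ ℤ.+ i) ℤ.* (b ℤ.* b) ℤ.- a ℤ.* (n ℤ.* b) ℤ.+ i ℤ.* (a ℤ.* b) ≡
    (ℤ.1ℤ ℤ.+ i) ℤ.* (b ℤ.* b) ℤ.- b ℤ.* (n ℤ.* a) ℤ.+ i ℤ.* (a ℤ.* b)
  middle = solve-∀
  after : ∀ i a b → (ℤ.1ℤ ℤ.+ i) ℤ.* (b ℤ.* b) ℤ.- b ℤ.* (i ℤ.* b ℤ.+ (i ℤ.- ℤ.1ℤ) ℤ.* a) ℤ.+ i ℤ.* (a ℤ.* b) ≡
    (a ℤ.+ b) ℤ.* b
  after = solve-∀

-- From integer to rational coefficients

fromℤ : ℤ → ℚ
fromℤ z = z ℚ./ 1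

-- Normalisation by the gcd blocks computation in ℚ; among unnormalised fractions the claim is a
-- cross-multiplication.
fromℤ-+ : ∀ x y → fromℤ (x ℤ.+ y) ≡ fromℤ x ℚ.+ fromℤ y
fromℤ-+ x y = ℚ.toℚᵘ-injective (begin
  ℚ.toℚᵘ (fromℤ (x ℤ.+ y))
    ≈⟨ ℚ.toℚᵘ-fromℚᵘ (mkℚᵘ (x ℤ.+ y) 0) ⟩
  mkℚᵘ (x ℤ.+ y) 0
    ≈⟨ *≡* (cross x y) ⟩
  mkℚᵘ x 0 ℚᵘ.+ mkℚᵘ y 0
    ≈⟨ ℚᵘ.+-cong (ℚ.toℚᵘ-fromℚᵘ (mkℚᵘ x 0)) (ℚ.toℚᵘ-fromℚᵘ (mkℚᵘ y 0)) ⟨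
  ℚ.toℚᵘ (fromℤ x) ℚᵘ.+ ℚ.toℚᵘ (fromℤ y)
    ≈⟨ ℚ.toℚᵘ-homo-+ (fromℤ x) (fromℤ y) ⟨
  ℚ.toℚᵘ (fromℤ x ℚ.+ fromℤ y) ∎)
  where
  open SetoidReasoning ℚᵘ.≃-setoid
  cross : ∀ x y → (x ℤ.+ y) ℤ.* ℤ.1ℤ ≡ (x ℤ.* ℤ.1ℤ ℤ.+ y ℤ.* ℤ.1ℤ) ℤ.* ℤ.1ℤ
  cross = solve-∀

*≡⇒fromℤ≡/ : ∀ {z y} d → z ℤ.* + suc d ≡ y → fromℤ z ≡ y ℚ./ suc d
*≡⇒fromℤ≡/ {z} {y} d eq = ℚ.fromℚᵘ-cong {mkℚᵘ z 0} {mkℚᵘ y d} (*≡* (≡.trans eq (≡.sym (ℤ.*-identityʳ y))))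

coeff-motzkin : ∀ n k j → coeff (motzkin polyRing t n k) j ≡ fromℤ (motzkinCoeff n k (suc j))
coeff-motzkin zero    zero                j             rewrite motzkinCoeff-boundary 0 (suc j) = ≡.refl
coeff-motzkin zero    (suc zero)          zero          = ≡.refl
coeff-motzkin zero    (suc zero)          (suc zero)    = ≡.refl
coeff-motzkin zero    (suc zero)          (suc (suc j)) = ≡.refl
coeff-motzkin zero    (suc (suc k))       j
  rewrite ℕ.+-suc k j | ℤ.*-zeroʳ (pascal 0 (2 ℕ.+ j)) | ℤ.*-zeroʳ (pascal 0 (1 ℕ.+ j)) = ≡.refl
coeff-motzkin (suc n) zero                j             rewrite motzkinCoeff-boundary (suc n) (suc j) = ≡.refl
coeff-motzkin (suc n) (suc k)             j             = begin
  coeff (A + (const 1ℚ + t) * B + t * D) j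
    ≡⟨ coeff-≡ expand j ⟩
  coeff (A + (B + (0ℚ ∷ B)) + (0ℚ ∷ D)) j
    ≡⟨ ≡.trans (coeff-+ (A + (B + (0ℚ ∷ B))) (0ℚ ∷ D) j) (≡.cong (ℚ._+ coeff (0ℚ ∷ D) j)
         (≡.trans (coeff-+ A (B + (0ℚ ∷ B)) j) (≡.cong (coeff A j ℚ.+_) (coeff-+ B (0ℚ ∷ B) j)))) ⟩
  coeff A j ℚ.+ (coeff B j ℚ.+ coeff (0ℚ ∷ B) j) ℚ.+ coeff (0ℚ ∷ D) j
    ≡⟨ ≡.cong₂ ℚ._+_
         (≡.cong₂ ℚ._+_ (coeff-motzkin n k j) (≡.cong₂ ℚ._+_ (coeff-motzkin n (suc k) j) (coeff-0∷ (suc k) j)))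
         (coeff-0∷ (suc (suc k)) j) ⟩
  fromℤ a ℚ.+ (fromℤ b ℚ.+ fromℤ b′) ℚ.+ fromℤ d
    ≡⟨ ≡.trans (fromℤ-+ (a ℤ.+ (b ℤ.+ b′)) d) (≡.cong (ℚ._+ fromℤ d)
         (≡.trans (fromℤ-+ a (b ℤ.+ b′)) (≡.cong (fromℤ a ℚ.+_) (fromℤ-+ b b′)))) ⟨
  fromℤ (a ℤ.+ (b ℤ.+ b′) ℤ.+ d)
    ≡⟨ ≡.cong fromℤ (motzkinCoeff-step n k j) ⟨
  fromℤ (motzkinCoeff (suc n) (suc k) (suc j)) ∎
  where
  open ≡.≡-Reasoning
  A B D : Poly
  A = motzkin polyRing t n k
  B = motzkin polyRing t n (suc k)
  D = motzkin polyRing t n (suc (suc k))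
  a b b′ d : ℤ
  a = motzkinCoeff n k (suc j)
  b = motzkinCoeff n (suc k) (suc j)
  b′ = motzkinCoeff n (suc k) j
  d = motzkinCoeff n (suc (suc k)) j
  expand : A + (const 1ℚ + t) * B + t * D ≈ A + (B + (0ℚ ∷ B)) + (0ℚ ∷ D)
  expand = +-cong
    (+-cong (≈-refl {A}) (≈-trans (*-distribʳ-+ B (const 1ℚ) t) (+-cong (*-identityˡ B) (t-* B))))
    (t-* D)
  -- Index 0 of `motzkinCoeff` stands for t^(-1) and vanishes, so multiplication by t is a plain
  -- index shift even in degree 0.
  coeff-0∷ : ∀ k j → coeff (0ℚ ∷ motzkin polyRing t n k) j ≡ fromℤ (motzkinCoeff n k j)
  coeff-0∷ k zero    rewrite motzkinCoeff-0 n k = ≡.refl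
  coeff-0∷ k (suc j) = coeff-motzkin n k j

-- As in Horner's scheme, pulling one `t` out of the terms after the first leaves `c 0 ∷ S`, with
-- `S` a sum of the same shape.
coeff-∑ : ∀ N (c : ℕ → ℚ) → (∀ k → N ℕ.≤ k → c k ≡ 0ℚ) →
  ∀ j → coeff (sum {N} λ i → const (c (toℕ i)) * t ^ toℕ i) j ≡ c j
coeff-∑ zero    c c≡0 j = ≡.sym (c≡0 j z≤n)
coeff-∑ (suc N) c c≡0 j = ≡.trans (coeff-≡ step j) (by-cases j)
  where
  S : Poly
  S = sum {N} λ i → const (c (suc (toℕ i))) * t ^ toℕ i
  open CommutativeRing polyRing using (semiring)
  open import Algebra.Properties.Semiring.Sum semiring using (*-distribˡ-sum)
  step : sum {suc N} (λ i → const (c (toℕ i)) * t ^ toℕ i) ≈ c 0 ∷ S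
  step = begin
    const (c 0) * const 1ℚ + sum {N} (λ i → const (c (suc (toℕ i))) * (t * t ^ toℕ i))
      ≈⟨ +-cong (≈-trans (*-comm (const (c 0)) (const 1ℚ)) (*-identityˡ (const (c 0))))
           (sum-cong polyRing {N} λ i → x∙yz≈y∙xz* (const (c (suc (toℕ i)))) t (t ^ toℕ i)) ⟩
    const (c 0) + sum {N} (λ i → t * (const (c (suc (toℕ i))) * t ^ toℕ i))
      ≈⟨ +-cong (≈-refl {const (c 0)}) (*-distribˡ-sum {N} t (λ i → const (c (suc (toℕ i))) * t ^ toℕ i)) ⟨
    const (c 0) + t * S
      ≈⟨ +-cong (≈-refl {const (c 0)}) (t-* S) ⟩
    const (c 0) + (0ℚ ∷ S)
      ≈⟨ ∷-cong (ℚ.+-identityʳ (c 0)) (≈-refl {S}) ⟩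
    c 0 ∷ S ∎
    where
    open ≈-Reasoning
    open import Algebra.Properties.CommutativeSemigroup (CommutativeRing.*-commutativeSemigroup polyRing)
      using () renaming (x∙yz≈y∙xz to x∙yz≈y∙xz*)
  by-cases : ∀ j → coeff (c 0 ∷ S) j ≡ c j
  by-cases zero    = ≡.refl
  by-cases (suc j) = coeff-∑ N (c ∘ suc) (λ k N≤k → c≡0 (suc k) (s≤s N≤k)) j

narayana≈motzkin : ∀ m → narayana (suc m) ≈ motzkin polyRing t m 1
narayana≈motzkin m = mk≈ λ j → begin
  coeff (narayana (suc m)) j
    ≡⟨ coeff-∑ (suc (suc m)) c c≡0 j ⟩
  c j
    ≡⟨ *≡⇒fromℤ≡/ {motzkinCoeff m 1 (suc j)} j (motzkinCoeff-narayana m j) ⟨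
  fromℤ (motzkinCoeff m 1 (suc j))
    ≡⟨ coeff-motzkin m 1 j ⟨
  coeff (motzkin polyRing t m 1) j ∎
  where
  open ≡.≡-Reasoning
  c : ℕ → ℚ
  c k = (+ ((suc m C k) ℕ.* (m C k))) ℚ./ suc k
  c≡0 : ∀ k → suc (suc m) ℕ.≤ k → c k ≡ 0ℚ
  c≡0 k m<k rewrite k>n⇒nCk≡0 m<k = ≡.sym (*≡⇒fromℤ≡/ {ℤ.0ℤ} {ℤ.0ℤ} k ≡.refl)

theorem4p1 : ∀ (n : ℕ) →
    det polyRawRing {n} (λ i j →
    narayana (toℕ i ℕ.+ toℕ j ℕ.+ 1) + narayana (toℕ i ℕ.+ toℕ j ℕ.+ 2))
    ≈ (- const 1ℚ) ^ n * t ^ (n C 2) * fib polyRawRing (n ℕ.+ 1) (- t - const (+ 2 ℚ./ 1)) (- t)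
theorem4p1 n = begin
  det polyRawRing {n} (λ i j → narayana (toℕ i ℕ.+ toℕ j ℕ.+ 1) + narayana (toℕ i ℕ.+ toℕ j ℕ.+ 2))
    ≈⟨ det-cong polyRing {n} _ _ (λ i j → +-cong
         (entry (toℕ i ℕ.+ toℕ j) (ℕ.+-comm _ 1))
         (entry (toℕ i ℕ.+ suc (toℕ j)) (≡.trans (ℕ.+-comm _ 2) (≡.cong suc (≡.sym (ℕ.+-suc (toℕ i) (toℕ j))))))) ⟩
  det polyRawRing {n} (λ i j →
    motzkin polyRing t (toℕ i ℕ.+ toℕ j) 1 + motzkin polyRing t (toℕ i ℕ.+ suc (toℕ j)) 1)
    ≈⟨ det-moments polyRing t n ⟩
  t ^ (n C 2) * det polyRawRing (Tridiagonal polyRing t n)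
    ≈⟨ *-congˡ (t ^ (n C 2)) (det-Tridiagonal polyRing t x (- t) x≈ (≈-sym (-1*x≈-x t)) n) ⟩
  t ^ (n C 2) * ((- const 1ℚ) ^ n * fib polyRawRing (suc n) x (- t))
    ≈⟨ *-assoc (t ^ (n C 2)) ((- const 1ℚ) ^ n) (fib polyRawRing (suc n) x (- t)) ⟨
  t ^ (n C 2) * (- const 1ℚ) ^ n * fib polyRawRing (suc n) x (- t)
    ≈⟨ *-cong (*-comm (t ^ (n C 2)) ((- const 1ℚ) ^ n)) (≈-refl {fib polyRawRing (suc n) x (- t)}) ⟩
  (- const 1ℚ) ^ n * t ^ (n C 2) * fib polyRawRing (suc n) x (- t)
    ≡⟨ ≡.cong (λ m → (- const 1ℚ) ^ n * t ^ (n C 2) * fib polyRawRing m x (- t)) (ℕ.+-comm 1 n) ⟩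
  (- const 1ℚ) ^ n * t ^ (n C 2) * fib polyRawRing (n ℕ.+ 1) x (- t) ∎
  where
  open ≈-Reasoning
  open import Algebra.Properties.Ring (CommutativeRing.ring polyRing) using (-1*x≈-x)
  x : Poly
  x = - t - const (+ 2 ℚ./ 1)
  x≈ : x ≈ (- const 1ℚ) * (const 1ℚ + const 1ℚ + t)
  -- Both sides are closed lists, so every coefficient is found by computation.
  x≈ = mk≈ λ { zero → ≡.refl ; (suc zero) → ≡.refl ; (suc (suc k)) → ≡.refl }
  entry : ∀ m {k} → k ≡ suc m → narayana k ≈ motzkin polyRing t m 1
  entry m ≡.refl = narayana≈motzkin m
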